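{- The supremum of $\chi_{fb}(G,\sigma)$ over all planar signed simple graphs $(G,\sigma)$ is at least $2+\frac{1}{41}=\frac{83}{41}$.
   Context: A signed graph $(G,\sigma)$ is a graph $G$ together with a signature $\sigma: E(G)\to\{+,-\}$. A cycle is negative if it has an odd number of negative edges. A set of vertices is balanced if the subgraph it induces contains no negative cycle. For positive integers $p,q$, a balanced $(p,q)$-coloring of $(G,\sigma)$ is an assignment to each vertex of a set of $q$ colors from $\{1,\dots,p\}$ such that, for each color, the set of vertices receiving that color is balanced. The fractional balanced chromatic number $\chi_{fb}(G,\sigma)$ is the minimum of $p/q$ over all pairs $(p,q)$ for which a balanced $(p,q)$-coloring exists. A simple graph has no loops and no parallel edges. -}

module Defs where

open import Data.Nat using (ℕ; _≤_; _<_)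
open import Data.Fin using (Fin)
open import Data.Fin.Subset using (Subset; _∈_; ∣_∣)
open import Data.Sign using (Sign) renaming (_*_ to _*ₛ_)
open import Data.Maybe using (Maybe; just; nothing)
open import Data.List using (List; []; _∷_; _++_; zip; length)
open import Data.List.Relation.Unary.All using (All)
open import Data.List.Relation.Unary.Unique.Propositional using (Unique)
open import Data.Product using (Σ; ∃; _×_; _,_)
open import Data.Empty using (⊥)
open import Relation.Nullary using (¬_)
open import Relation.Binary.PropositionalEquality using (_≡_; _≢_)
import Data.Rational as ℚ
open ℚ using (ℚ; 0ℚ; 1ℚ)

-- A finite simple signed graph on vertex set Fin n.
-- sig u v = just s  iff  uv is an edge with sign s; nothing = no edge.
-- Symmetry + no loops; a function cannot encode parallel edges, so simple.
record SignedGraph : Set where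
  field
    n     : ℕ
    sig   : Fin n → Fin n → Maybe Sign
    sym   : ∀ u v → sig u v ≡ sig v u
    noLoop : ∀ v → sig v v ≡ nothing
open SignedGraph public

module _ (G : SignedGraph) where

  Adj : Fin (n G) → Fin (n G) → Set
  Adj u v = ∃ λ s → sig G u v ≡ just s

  cycleEdges : List (Fin (n G)) → List (Fin (n G) × Fin (n G))
  cycleEdges [] = []
  cycleEdges (v ∷ vs) = zip (v ∷ vs) (vs ++ v ∷ [])

  pathSign : List (Fin (n G) × Fin (n G)) → Maybe Sign
  pathSign [] = just Sign.+
  pathSign ((u , v) ∷ ps) with sig G u v | pathSign ps
  ... | just s | just t = just (s *ₛ t)
  ... | _      | _      = nothing

  NegativeCycle : List (Fin (n G)) → Set
  NegativeCycle vs = Unique vs × 3 ≤ length vs × pathSign (cycleEdges vs) ≡ just Sign.-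

  Balanced : (Fin (n G) → Set) → Set
  Balanced X = ∀ vs → NegativeCycle vs → All X vs → ⊥

  BalancedColoring : ℕ → ℕ → Set
  BalancedColoring p q =
    1 ≤ p × 1 ≤ q ×
    Σ (Fin (n G) → Subset p) λ c →
      (∀ v → ∣ c v ∣ ≡ q) × (∀ (k : Fin p) → Balanced (λ v → k ∈ c v))

Point : Set
Point = ℚ × ℚ

OnSegment : Point → Point → Point → Set
OnSegment (x₁ , x₂) (a₁ , a₂) (b₁ , b₂) =
  ∃ λ t → 0ℚ ℚ.≤ t × t ℚ.≤ 1ℚ ×
    x₁ ≡ a₁ ℚ.+ t ℚ.* (b₁ ℚ.- a₁) × x₂ ≡ a₂ ℚ.+ t ℚ.* (b₂ ℚ.- a₂)

-- Planarity via straight-line drawings (Fáry's theorem): an injective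
-- placement of vertices such that no vertex lies on an edge not incident
-- to it, and edges without common endpoint have disjoint segments.
StraightLineDrawing : (G : SignedGraph) → (Fin (n G) → Point) → Set
StraightLineDrawing G pos =
  (∀ u v → pos u ≡ pos v → u ≡ v) ×
  (∀ a b w → Adj G a b → w ≢ a → w ≢ b → ¬ OnSegment (pos w) (pos a) (pos b)) ×
  (∀ a b c d → Adj G a b → Adj G c d → a ≢ c → a ≢ d → b ≢ c → b ≢ d →
     ¬ (∃ λ x → OnSegment x (pos a) (pos b) × OnSegment x (pos c) (pos d)))

Planar : SignedGraph → Set
Planar G = ∃ λ pos → StraightLineDrawing G pos

{-# OPTIONS --safe #-}

-- A single graph with 58 vertices and χ_fb ≥ 81/40 > 83/41 suffices.  The bound 81/40 comes from a
-- list of 81 vertex occurrences that meets every balanced set at most 40 times: counting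
-- (occurrence, colour) incidences in a (p,q)-coloring then gives 81 q ≤ 40 p.  The list consists
-- of the corners of 19 K₄'s whose triangles are all negative, each of which meets a balanced set in
-- at most two vertices, and of the five core vertices 0, 3, 4, 5, 6.  So it must be shown that every
-- member of a balanced set among these five, beyond the first two, is paid for by a K₄ that is met
-- in fewer than two vertices.  This follows from the structure of the core, where balanced sets
-- containing 0 and 3, or 5 and 6, already pay inside one of two copies of a gadget: a balanced set
-- containing the gadget vertices 1 and 2 cannot meet all seven K₄'s of the gadget in two vertices.
-- Each of these claims is a short backtracking search cut off by explicit negative cycles.
module Submission where

open import Defs
open import Algebra.Properties.CommutativeSemigroup using (interchange)
open import Data.Bool using (Bool; true; false; _∧_; _∨_; T; if_then_else_)
open import Data.Bool.ListAction using (all; any)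
open import Data.Bool.Properties using (T-∧; T-∨; T-≡; ∨-comm)
open import Data.Empty using (⊥-elim)
open import Data.Fin using (Fin; zero; suc; toℕ)
import Data.Fin.Properties as Finₚ
open import Data.Fin.Properties using (toℕ<n; toℕ-injective)
open import Data.Fin.Subset using (Subset; _∈_; ∣_∣)
import Data.Integer as ℤ
import Data.Integer.Properties as ℤₚ
open import Data.List using (List; []; _∷_; map; concatMap; length; _++_; upTo)
open import Data.List.Membership.Propositional.Properties using (∈-upTo⁺)
open import Data.List.Relation.Unary.All as All using (All; []; _∷_)
import Data.List.Relation.Unary.All.Properties as Allₚ
open import Data.List.Relation.Unary.AllPairs using (AllPairs; []; _∷_; allPairs?)
import Data.List.Relation.Unary.Any.Properties as Anyₚ
open import Data.List.Relation.Unary.Unique.DecPropositional using (unique?)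
open import Data.Maybe using (Maybe; just; nothing; fromMaybe)
import Data.Maybe.Properties as Maybeₚ
open import Data.Nat as ℕ using (ℕ; zero; suc; _+_; _*_; _⊓_; _<_; _≤_; _≤ᵇ_; _≡ᵇ_; _<?_; _≤?_; z≤n; s≤s)
open import Data.Nat.Coprimality using (1-coprimeTo) renaming (sym to coprime-sym)
open import Data.Nat.DivMod using (_mod_)
open import Data.Nat.ListAction using (sum)
import Data.Nat.Properties as ℕₚ
import Data.Nat.Solver
open import Data.Product as Product using (Σ; ∃; _×_; _,_; proj₁; proj₂)
open import Data.Product.Properties using (≡-dec)
import Data.Rational as ℚ
open ℚ using (ℚ; 0ℚ; 1ℚ)
import Data.Rational.Properties as ℚₚ
import Data.Rational.Unnormalised as ℚᵘ
import Data.Rational.Unnormalised.Properties as ℚᵘₚ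
open import Data.Rational.Solver using (module +-*-Solver)
open import Data.Sign as Sign using (Sign)
open import Data.Sum as Sum using (_⊎_; inj₁; inj₂)
open import Data.Unit using (tt)
open import Data.Vec using ([]; _∷_; lookup; head; tail)
open import Data.Vec.Properties using (lookup⇒[]=)
open import Function using (_∘_; id; Equivalence)
open import Relation.Nullary using (¬_; Dec; ¬?; _×-dec_; _⊎-dec_; _→-dec_)
open import Relation.Nullary.Decidable using (toWitness; from-yes)
open import Relation.Nullary.Negation using (contradiction)
open import Relation.Binary.PropositionalEquality
  using (_≡_; _≢_; refl; trans; cong; cong₂; subst; subst₂) renaming (sym to ≡-sym)

-- Straight-line drawings on the integer grid

-- Denominator 1 is written out literally, so no gcd normalisation intervenes and injectivity is
-- read off the numerator.
ι : ℕ → ℚ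
ι n = ℚ.mkℚ (ℤ.+ n) 0 (coprime-sym (1-coprimeTo n))

ι-+ : ∀ m n → ι (m + n) ≡ ι m ℚ.+ ι n
ι-+ m n = ℚₚ.toℚᵘ-injective (ℚᵘₚ.≃-trans
  (ℚᵘ.*≡* (cong (ℤ._* ℤ.1ℤ) (trans (ℤₚ.pos-+ m n)
    (≡-sym (cong₂ ℤ._+_ (ℤₚ.*-identityʳ (ℤ.+ m)) (ℤₚ.*-identityʳ (ℤ.+ n)))))))
  (ℚᵘₚ.≃-sym (ℚₚ.toℚᵘ-homo-+ (ι m) (ι n))))

ι-* : ∀ m n → ι (m * n) ≡ ι m ℚ.* ι n
ι-* m n = ℚₚ.toℚᵘ-injective (ℚᵘₚ.≃-trans
  (ℚᵘ.*≡* (cong (ℤ._* ℤ.1ℤ) (ℤₚ.pos-* m n)))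
  (ℚᵘₚ.≃-sym (ℚₚ.toℚᵘ-homo-* (ι m) (ι n))))

ι-< : ∀ {m n} → m < n → ι m ℚ.< ι n
ι-< m<n = ℚ.*<* (ℤₚ.*-monoʳ-<-pos ℤ.1ℤ (ℤ.+<+ m<n))

ι-injective : ∀ {m n} → ι m ≡ ι n → m ≡ n
ι-injective eq = ℤₚ.+-injective (cong ℚ.numerator eq)

≤⇒0≤- : ∀ {x y} → x ℚ.≤ y → 0ℚ ℚ.≤ y ℚ.- x
≤⇒0≤- {x} {y} x≤y = subst (ℚ._≤ y ℚ.- x) (ℚₚ.+-inverseʳ x) (ℚₚ.+-monoˡ-≤ (ℚ.- x) x≤y)

<⇒0<- : ∀ {x y} → x ℚ.< y → 0ℚ ℚ.< y ℚ.- x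
<⇒0<- {x} {y} x<y = subst (ℚ._< y ℚ.- x) (ℚₚ.+-inverseʳ x) (ℚₚ.+-monoˡ-< (ℚ.- x) x<y)

GridPoint : Set
GridPoint = ℕ × ℕ

⟦_⟧ : GridPoint → Point
⟦ x , y ⟧ = ι x , ι y

⟦⟧-injective : ∀ {a b} → ⟦ a ⟧ ≡ ⟦ b ⟧ → a ≡ b
⟦⟧-injective eq = cong₂ _,_ (ι-injective (cong proj₁ eq)) (ι-injective (cong proj₂ eq))

-- The three positive terms of the orientation determinant. Separating terms by sign keeps every
-- orientation test inside `ℕ`, where evaluation decides it.
loop : GridPoint → GridPoint → GridPoint → ℕ
loop (a₁ , a₂) (b₁ , b₂) (c₁ , c₂) = a₁ * b₂ + b₁ * c₂ + c₁ * a₂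

-- The determinant of (b − a, c − a) is loop a b c − loop b a c.
Left : GridPoint → GridPoint → GridPoint → Set
Left a b c = loop b a c < loop a b c

det : Point → Point → Point → ℚ
det (a₁ , a₂) (b₁ , b₂) (c₁ , c₂) =
  (a₁ ℚ.* b₂ ℚ.+ b₁ ℚ.* c₂ ℚ.+ c₁ ℚ.* a₂) ℚ.- (b₁ ℚ.* a₂ ℚ.+ a₁ ℚ.* c₂ ℚ.+ c₁ ℚ.* b₂)

ι-loop : ∀ a₁ a₂ b₁ b₂ c₁ c₂ → ι (a₁ * b₂ + b₁ * c₂ + c₁ * a₂) ≡
         ι a₁ ℚ.* ι b₂ ℚ.+ ι b₁ ℚ.* ι c₂ ℚ.+ ι c₁ ℚ.* ι a₂
ι-loop a₁ a₂ b₁ b₂ c₁ c₂ =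
  trans (ι-+ (a₁ * b₂ + b₁ * c₂) (c₁ * a₂))
    (cong₂ ℚ._+_ (trans (ι-+ (a₁ * b₂) (b₁ * c₂)) (cong₂ ℚ._+_ (ι-* a₁ b₂) (ι-* b₁ c₂)))
                 (ι-* c₁ a₂))

Left⇒det>0 : ∀ a b c → Left a b c → 0ℚ ℚ.< det ⟦ a ⟧ ⟦ b ⟧ ⟦ c ⟧
Left⇒det>0 (a₁ , a₂) (b₁ , b₂) (c₁ , c₂) left =
  <⇒0<- (subst₂ ℚ._<_ (ι-loop b₁ b₂ a₁ a₂ c₁ c₂) (ι-loop a₁ a₂ b₁ b₂ c₁ c₂) (ι-< left))

onSegment-sym : ∀ x a b → OnSegment x a b → OnSegment x b a
onSegment-sym (x₁ , x₂) (a₁ , a₂) (b₁ , b₂) (t , 0≤t , t≤1 , e₁ , e₂) =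
  1ℚ ℚ.- t ,
  ≤⇒0≤- t≤1 ,
  subst (1ℚ ℚ.- t ℚ.≤_) (ℚₚ.+-identityʳ 1ℚ) (ℚₚ.+-monoʳ-≤ 1ℚ (ℚₚ.neg-antimono-≤ 0≤t)) ,
  trans e₁ (flip-ends a₁ b₁) , trans e₂ (flip-ends a₂ b₂)
  where
  open +-*-Solver
  flip-ends : ∀ u v → u ℚ.+ t ℚ.* (v ℚ.- u) ≡ v ℚ.+ (1ℚ ℚ.- t) ℚ.* (u ℚ.- v)
  flip-ends u v = solve 3 (λ u v t → u :+ t :* (v :- u) := v :+ (con 1ℚ :- t) :* (u :- v)) refl u v t

onSegment⇒det≡0 : ∀ x a b → OnSegment x a b → det a b x ≡ 0ℚ
onSegment⇒det≡0 (x₁ , x₂) (a₁ , a₂) (b₁ , b₂) (t , _ , _ , refl , refl) =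
  solve 5 (λ a₁ a₂ b₁ b₂ t →
    let c₁ = a₁ :+ t :* (b₁ :- a₁); c₂ = a₂ :+ t :* (b₂ :- a₂) in
    (a₁ :* b₂ :+ b₁ :* c₂ :+ c₁ :* a₂) :- (b₁ :* a₂ :+ a₁ :* c₂ :+ c₁ :* b₂) := con 0ℚ)
    refl a₁ a₂ b₁ b₂ t
  where open +-*-Solver

0≤* : ∀ {x y} → 0ℚ ℚ.≤ x → 0ℚ ℚ.≤ y → 0ℚ ℚ.≤ x ℚ.* y
0≤* {x} {y} 0≤x 0≤y = subst (ℚ._≤ x ℚ.* y) (ℚₚ.*-zeroˡ y)
  (ℚₚ.*-monoʳ-≤-nonNeg y {{ℚ.nonNegative 0≤y}} 0≤x)

-- The value lies between `p` and `q`, so each case writes it as the smaller of the two plus a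
-- nonnegative term.
convex-pos : ∀ p q s → 0ℚ ℚ.< p → 0ℚ ℚ.< q → 0ℚ ℚ.≤ s → s ℚ.≤ 1ℚ → 0ℚ ℚ.< p ℚ.+ s ℚ.* (q ℚ.- p)
convex-pos p q s 0<p 0<q 0≤s s≤1 with ℚₚ.≤-total p q
... | inj₁ p≤q = ℚₚ.<-≤-trans 0<p (subst (ℚ._≤ p ℚ.+ s ℚ.* (q ℚ.- p)) (ℚₚ.+-identityʳ p)
  (ℚₚ.+-monoʳ-≤ p (0≤* 0≤s (≤⇒0≤- p≤q))))
... | inj₂ q≤p = ℚₚ.<-≤-trans 0<q (subst₂ ℚ._≤_ (ℚₚ.+-identityʳ q)
  (solve 3 (λ p q s → q :+ (con 1ℚ :- s) :* (p :- q) := p :+ s :* (q :- p)) refl p q s)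
  (ℚₚ.+-monoʳ-≤ q (0≤* (≤⇒0≤- s≤1) (≤⇒0≤- q≤p))))
  where open +-*-Solver

-- `det a b` is affine in its third argument, so along the segment it interpolates its two positive
-- end values.
det-pos-on-segment : ∀ a b c d x → 0ℚ ℚ.< det a b c → 0ℚ ℚ.< det a b d →
                     OnSegment x c d → 0ℚ ℚ.< det a b x
det-pos-on-segment a@(a₁ , a₂) b@(b₁ , b₂) c@(c₁ , c₂) d@(d₁ , d₂) x 0<p 0<q
  (s , 0≤s , s≤1 , refl , refl) =
  subst (0ℚ ℚ.<_)
    (solve 9 (λ a₁ a₂ b₁ b₂ c₁ c₂ d₁ d₂ s →
      let D = λ x₁ x₂ → (a₁ :* b₂ :+ b₁ :* x₂ :+ x₁ :* a₂) :- (b₁ :* a₂ :+ a₁ :* x₂ :+ x₁ :* b₂)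
      in D c₁ c₂ :+ s :* (D d₁ d₂ :- D c₁ c₂) := D (c₁ :+ s :* (d₁ :- c₁)) (c₂ :+ s :* (d₂ :- c₂)))
      refl a₁ a₂ b₁ b₂ c₁ c₂ d₁ d₂ s)
    (convex-pos (det a b c) (det a b d) s 0<p 0<q 0≤s s≤1)
  where open +-*-Solver

left-not-on-segment : ∀ a b w → Left a b w → ¬ OnSegment ⟦ w ⟧ ⟦ a ⟧ ⟦ b ⟧
left-not-on-segment a b w left on =
  ℚₚ.<-irrefl (≡-sym (onSegment⇒det≡0 ⟦ w ⟧ ⟦ a ⟧ ⟦ b ⟧ on)) (Left⇒det>0 a b w left)

Beside : GridPoint → GridPoint → GridPoint → GridPoint → Set
Beside a b c d = (Left a b c × Left a b d) ⊎ (Left b a c × Left b a d)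

Apart : GridPoint → GridPoint → GridPoint → GridPoint → Set
Apart a b c d = Beside a b c d ⊎ Beside c d a b

Disjoint : Point → Point → Point → Point → Set
Disjoint a b c d = ¬ (∃ λ x → OnSegment x a b × OnSegment x c d)

left-disjoint : ∀ a b c d → Left a b c → Left a b d → Disjoint ⟦ a ⟧ ⟦ b ⟧ ⟦ c ⟧ ⟦ d ⟧
left-disjoint a b c d lc ld (x , on₁ , on₂) =
  ℚₚ.<-irrefl (≡-sym (onSegment⇒det≡0 x ⟦ a ⟧ ⟦ b ⟧ on₁))
    (det-pos-on-segment ⟦ a ⟧ ⟦ b ⟧ ⟦ c ⟧ ⟦ d ⟧ x (Left⇒det>0 a b c lc) (Left⇒det>0 a b d ld) on₂)

beside-disjoint : ∀ a b c d → Beside a b c d → Disjoint ⟦ a ⟧ ⟦ b ⟧ ⟦ c ⟧ ⟦ d ⟧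
beside-disjoint a b c d (inj₁ (lc , ld)) = left-disjoint a b c d lc ld
beside-disjoint a b c d (inj₂ (lc , ld)) (x , on₁ , on₂) =
  left-disjoint b a c d lc ld (x , onSegment-sym x ⟦ a ⟧ ⟦ b ⟧ on₁ , on₂)

apart-disjoint : ∀ a b c d → Apart a b c d → Disjoint ⟦ a ⟧ ⟦ b ⟧ ⟦ c ⟧ ⟦ d ⟧
apart-disjoint a b c d (inj₁ beside) = beside-disjoint a b c d beside
apart-disjoint a b c d (inj₂ beside) (x , on₁ , on₂) = beside-disjoint c d a b beside (x , on₂ , on₁)

-- Double counting

bit : Bool → ℕ
bit b = if b then 1 else 0

count : {A : Set} → (A → Bool) → List A → ℕ
count P []       = 0
count P (x ∷ xs) = bit (P x) + count P xs

count-map : {A B : Set} (P : B → Bool) (f : A → B) (xs : List A) →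
            count P (map f xs) ≡ count (P ∘ f) xs
count-map P f []       = refl
count-map P f (x ∷ xs) = cong (bit (P (f x)) +_) (count-map P f xs)

count-++ : {A : Set} (P : A → Bool) (xs ys : List A) → count P (xs ++ ys) ≡ count P xs + count P ys
count-++ P []       ys = refl
count-++ P (x ∷ xs) ys = trans (cong (bit (P x) +_) (count-++ P xs ys))
  (≡-sym (ℕₚ.+-assoc (bit (P x)) (count P xs) (count P ys)))

bit-mono : ∀ {a b} → (T a → T b) → bit a ≤ bit b
bit-mono {false}         _   = z≤n
bit-mono {true}  {true}  _   = s≤s z≤n
bit-mono {true}  {false} imp = ⊥-elim (imp tt)

count-mono : {A : Set} {P Q : A → Bool} → (∀ x → T (P x) → T (Q x)) → ∀ xs → count P xs ≤ count Q xs
count-mono imp []       = z≤n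
count-mono imp (x ∷ xs) = ℕₚ.+-mono-≤ (bit-mono (imp x)) (count-mono imp xs)

count-++₄ : {A : Set} (P : A → Bool) (ws xs ys zs : List A) →
            count P (ws ++ xs ++ ys ++ zs) ≡ count P ws + (count P xs + (count P ys + count P zs))
count-++₄ P ws xs ys zs =
  trans (count-++ P ws (xs ++ ys ++ zs)) (cong (count P ws +_)
    (trans (count-++ P xs (ys ++ zs)) (cong (count P xs +_) (count-++ P ys zs))))

size-∷ : ∀ {p} (x : Subset (suc p)) → ∣ x ∣ ≡ bit (head x) + ∣ tail x ∣
size-∷ (true  ∷ x) = refl
size-∷ (false ∷ x) = refl

sum-sizes-∷ : ∀ {p} (xs : List (Subset (suc p))) →
              sum (map ∣_∣ xs) ≡ count head xs + sum (map ∣_∣ (map tail xs))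
sum-sizes-∷ []       = refl
sum-sizes-∷ (x ∷ xs) = trans (cong₂ _+_ (size-∷ x) (sum-sizes-∷ xs))
  (interchange ℕₚ.+-commutativeSemigroup (bit (head x)) ∣ tail x ∣ (count head xs) (sum (map ∣_∣ (map tail xs))))

count-lookup-tail : ∀ {p} (k : Fin p) (xs : List (Subset (suc p))) →
                    count (λ x → lookup x k) (map tail xs) ≡ count (λ x → lookup x (suc k)) xs
count-lookup-tail k []             = refl
count-lookup-tail k ((b ∷ x) ∷ xs) = cong (bit (lookup x k) +_) (count-lookup-tail k xs)

count-head : ∀ {p} (xs : List (Subset (suc p))) → count head xs ≡ count (λ x → lookup x zero) xs
count-head []             = refl
count-head ((b ∷ x) ∷ xs) = cong (bit b +_) (count-head xs)

-- With the subsets as rows of a 0/1 matrix, induction on `p` removes one column, that is one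
-- colour, at a time; each column has at most `m` ones.
sum-sizes-≤ : ∀ {p} m (xs : List (Subset p)) →
              (∀ k → count (λ x → lookup x k) xs ≤ m) → sum (map ∣_∣ xs) ≤ p * m
sum-sizes-≤ {zero}  m []        bound = z≤n
sum-sizes-≤ {zero}  m ([] ∷ xs) bound = sum-sizes-≤ m xs λ ()
sum-sizes-≤ {suc p} m xs        bound =
  subst (_≤ m + p * m) (≡-sym (sum-sizes-∷ xs))
    (ℕₚ.+-mono-≤ (subst (_≤ m) (≡-sym (count-head xs)) (bound zero))
                 (sum-sizes-≤ m (map tail xs) λ k →
                   subst (_≤ m) (≡-sym (count-lookup-tail k xs)) (bound (suc k))))

sum-sizes : {A : Set} {p q : ℕ} (c : A → Subset p) → (∀ x → ∣ c x ∣ ≡ q) →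
            ∀ xs → sum (map ∣_∣ (map c xs)) ≡ length xs * q
sum-sizes c size []       = refl
sum-sizes c size (x ∷ xs) = cong₂ _+_ (size x) (sum-sizes c size xs)

-- Repetitions in `xs` act as integer vertex weights, so this is weak linear programming duality for
-- fractional colorings.
double-count : {A : Set} {p q m : ℕ} (c : A → Subset p) → (∀ x → ∣ c x ∣ ≡ q) →
               ∀ xs → (∀ k → count (λ x → lookup (c x) k) xs ≤ m) → length xs * q ≤ p * m
double-count {p = p} {m = m} c size xs bound = subst (_≤ p * m) (sum-sizes c size xs)
  (sum-sizes-≤ m (map c xs) λ k →
    subst (_≤ m) (≡-sym (count-map (λ x → lookup x k) c xs)) (bound k))

-- Backtracking over partially specified vertex sets

Partial : Set
Partial = ℕ → Maybe Bool

_[_↦_] : Partial → ℕ → Bool → Partial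
(σ [ v ↦ b ]) w = if w ≡ᵇ v then just b else σ w

-- The defaults are opposite: an undecided vertex is in for `possible` and out for `certain`, so
-- every set compatible with `σ` lies between the two. Counts are bounded above by the former;
-- contained cycles are detected by the latter.
possible certain : Partial → ℕ → Bool
possible σ v = fromMaybe true (σ v)
certain  σ v = fromMaybe false (σ v)

_⊨_ : (ℕ → Bool) → Partial → Set
S ⊨ σ = ∀ v b → σ v ≡ just b → S v ≡ b

⊨-extend : ∀ {S σ} v → S ⊨ σ → S ⊨ (σ [ v ↦ S v ])
⊨-extend {S} v ext w b eq with w ≡ᵇ v in w≡ᵇv
⊨-extend {S} v ext w b refl | true  =
  cong S (ℕₚ.≡ᵇ⇒≡ w v (Equivalence.from T-≡ w≡ᵇv))
⊨-extend {S} v ext w b eq   | false = ext w b eq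

member⇒possible : ∀ {S σ} → S ⊨ σ → ∀ v → T (S v) → T (possible σ v)
member⇒possible {S} {σ} ext v Sv with σ v in eq
... | nothing = tt
... | just b  = subst T (ext v b eq) Sv

certain⇒member : ∀ {S σ} → S ⊨ σ → ∀ {v} → T (certain σ v) → T (S v)
certain⇒member {S} {σ} ext {v} cv with σ v in eq
... | just b  = subst T (≡-sym (ext v b eq)) cv

Avoids : (ℕ → Bool) → List (List ℕ) → Set
Avoids S = All (λ C → ¬ All (T ∘ S) C)

module Search (cycles : List (List ℕ)) (enough : Partial → Bool) where

  closed : Partial → Bool
  closed σ = any (all (certain σ)) cycles ∨ enough σ

  search : List ℕ → Partial → Bool
  search []       σ = closed σ
  search (v ∷ vs) σ = closed σ ∨ (search vs (σ [ v ↦ false ]) ∧ search vs (σ [ v ↦ true ]))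

  module _ {S : ℕ → Bool} (avoids : Avoids S cycles) {P : Set}
           (conclude : ∀ σ → S ⊨ σ → T (enough σ) → P) where

    closed-sound : ∀ σ → S ⊨ σ → T (closed σ) → P
    closed-sound σ ext t with Equivalence.to T-∨ t
    ... | inj₂ e = conclude σ ext e
    ... | inj₁ h = let i = Anyₚ.any⁻ (all (certain σ)) cycles h in
      contradiction (All.map (certain⇒member ext) (Allₚ.all⁺ (certain σ) _ (proj₂ (All.lookupAny avoids i))))
                    (proj₁ (All.lookupAny avoids i))

    -- The values of `S` single out one path through the search tree. The node where it ends cannot
    -- have been closed by a cycle, since `S` would contain that cycle, so it was closed by
    -- `enough`.
    search-sound : ∀ vs σ → S ⊨ σ → T (search vs σ) → P
    search-sound []       σ ext t = closed-sound σ ext t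
    search-sound (v ∷ vs) σ ext t with Equivalence.to T-∨ t
    ... | inj₁ c = closed-sound σ ext c
    ... | inj₂ b = branch (S v) refl
      where
      branch : ∀ x → S v ≡ x → P
      branch false eq = search-sound vs _ (subst (λ x → S ⊨ (σ [ v ↦ x ])) eq (⊨-extend v ext))
                          (proj₁ (Equivalence.to T-∧ b))
      branch true  eq = search-sound vs _ (subst (λ x → S ⊨ (σ [ v ↦ x ])) eq (⊨-extend v ext))
                          (proj₂ (Equivalence.to T-∧ b))

-- Balanced sets against K₄'s with negative triangles

K₄ : Set
K₄ = ℕ × ℕ × ℕ × ℕ

corners : K₄ → List ℕ
corners (a , b , c , d) = a ∷ b ∷ c ∷ d ∷ []

triangles : K₄ → List (List ℕ)
triangles (a , b , c , d) =
  (a ∷ b ∷ c ∷ []) ∷ (a ∷ b ∷ d ∷ []) ∷ (a ∷ c ∷ d ∷ []) ∷ (b ∷ c ∷ d ∷ []) ∷ []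

≤2-of-4 : ∀ a b c d → ¬ (T a × T b × T c) → ¬ (T a × T b × T d) →
          ¬ (T a × T c × T d) → ¬ (T b × T c × T d) →
          bit a + (bit b + (bit c + (bit d + 0))) ≤ 2
≤2-of-4 true  true  true  d     abc _ _ _ = contradiction _ abc
≤2-of-4 true  true  false true  _ abd _ _ = contradiction _ abd
≤2-of-4 true  true  false false _ _ _ _   = s≤s (s≤s z≤n)
≤2-of-4 true  false true  true  _ _ acd _ = contradiction _ acd
≤2-of-4 true  false true  false _ _ _ _   = s≤s (s≤s z≤n)
≤2-of-4 true  false false true  _ _ _ _   = s≤s (s≤s z≤n)
≤2-of-4 true  false false false _ _ _ _   = s≤s z≤n
≤2-of-4 false true  true  true  _ _ _ bcd = contradiction _ bcd
≤2-of-4 false true  true  false _ _ _ _   = s≤s (s≤s z≤n)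
≤2-of-4 false true  false true  _ _ _ _   = s≤s (s≤s z≤n)
≤2-of-4 false true  false false _ _ _ _   = s≤s z≤n
≤2-of-4 false false true  true  _ _ _ _   = s≤s (s≤s z≤n)
≤2-of-4 false false true  false _ _ _ _   = s≤s z≤n
≤2-of-4 false false false true  _ _ _ _   = s≤s z≤n
≤2-of-4 false false false false _ _ _ _   = z≤n

corners-≤2 : ∀ {S} K → Avoids S (triangles K) → count S (corners K) ≤ 2
corners-≤2 {S} (a , b , c , d) (abc ∷ abd ∷ acd ∷ bcd ∷ []) =
  ≤2-of-4 (S a) (S b) (S c) (S d) (abc ∘ list) (abd ∘ list) (acd ∘ list) (bcd ∘ list)
  where
  list : ∀ {u v w} → T (S u) × T (S v) × T (S w) → All (T ∘ S) (u ∷ v ∷ w ∷ [])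
  list (u , v , w) = u ∷ v ∷ w ∷ []

-- A vertex shared by several K₄'s is counted once for each, which makes the bound of two per K₄
-- additive.
score : (ℕ → Bool) → List K₄ → ℕ
score S Ks = count S (concatMap corners Ks)

-- The cap 2 comes from the negative triangles. The contribution of a K₄ with distinct corners drops
-- below 2 exactly when at least three of its corners are excluded.
scoreCap : Partial → List K₄ → ℕ
scoreCap σ Ks = sum (map (λ K → count (possible σ) (corners K) ⊓ 2) Ks)

score≤scoreCap : ∀ {S σ} → S ⊨ σ → ∀ Ks → Avoids S (concatMap triangles Ks) →
                 score S Ks ≤ scoreCap σ Ks
score≤scoreCap ext []     _      = z≤n
score≤scoreCap {S} {σ} ext (K ∷ Ks) avoids =
  subst (_≤ scoreCap σ (K ∷ Ks)) (≡-sym (count-++ S (corners K) (concatMap corners Ks)))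
    (ℕₚ.+-mono-≤ (ℕₚ.⊓-glb (count-mono (member⇒possible ext) (corners K)) (corners-≤2 K (Allₚ.++⁻ˡ _ avoids)))
                 (score≤scoreCap ext Ks (Allₚ.++⁻ʳ (triangles K) avoids)))

-- The saving inside a gadget

empty : Partial
empty _ = nothing

⊨-empty : ∀ {S} → S ⊨ empty
⊨-empty v b ()

-- The gadget contains seven K₄'s, hence 14 = 2 · 7 in general and one less if y and z are both taken.
gadgetCap : (ℕ → Bool) → ℕ → ℕ → ℕ
gadgetCap S y z = if S y ∧ S z then 13 else 14

-- Enlarging the set can only trigger the smaller cap. This allows the unknown set to be replaced by
-- the vertices already `certain`, which the core search can evaluate.
gadgetCap-antitone : ∀ {P Q : ℕ → Bool} y z → (∀ {v} → T (P v) → T (Q v)) →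
                     gadgetCap Q y z ≤ gadgetCap P y z
gadgetCap-antitone {P} {Q} y z imp with P y ∧ P z in py∧pz | Q y ∧ Q z in qy∧qz
... | true  | true  = ℕₚ.≤-refl
... | true  | false =
  let py , pz = Equivalence.to T-∧ (Equivalence.from T-≡ py∧pz) in
  ⊥-elim (subst T qy∧qz (Equivalence.from T-∧ (imp py , imp pz)))
... | false | true  = ℕₚ.n≤1+n 13
... | false | false = ℕₚ.≤-refl

module _ (cycles : List (List ℕ)) (Ks : List K₄) (order : List ℕ) (y z : ℕ) where

  bothIn : Partial
  bothIn = (empty [ y ↦ true ]) [ z ↦ true ]

  gadgetSearch : Bool
  gadgetSearch = Search.search cycles (λ σ → scoreCap σ Ks ≤ᵇ 13) order bothIn

  -- Two per K₄ already gives 14. Only if both `y` and `z` are taken must one unit be saved, and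
  -- then the search starts with these two fixed: each branch either contains a negative cycle or
  -- excludes enough corners to bring the cap down to 13.
  score≤gadgetCap : ∀ {S} → Avoids S cycles → Avoids S (concatMap triangles Ks) →
                    scoreCap empty Ks ≡ 14 → T gadgetSearch → score S Ks ≤ gadgetCap S y z
  score≤gadgetCap {S} avoids avoidsK total ok with S y in sy | S z in sz
  ... | true  | true  =
    Search.search-sound cycles _ avoids
      (λ σ ext e → ℕₚ.≤-trans (score≤scoreCap ext Ks avoidsK) (ℕₚ.≤ᵇ⇒≤ _ _ e)) order bothIn
      (subst (λ b → S ⊨ (_ [ z ↦ b ])) sz
        (⊨-extend z (subst (λ b → S ⊨ (empty [ y ↦ b ])) sy (⊨-extend y ⊨-empty)))) ok
  ... | true  | false = subst (score S Ks ≤_) total (score≤scoreCap ⊨-empty Ks avoidsK)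
  ... | false | _     = subst (score S Ks ≤_) total (score≤scoreCap ⊨-empty Ks avoidsK)

-- Signed graphs from edge lists

Edge : Set
Edge = ℕ × ℕ × Sign

joins : ℕ → ℕ → Edge → Bool
joins i j (k , l , _) = ((k ≡ᵇ i) ∧ (l ≡ᵇ j)) ∨ ((k ≡ᵇ j) ∧ (l ≡ᵇ i))

signOf : List Edge → ℕ → ℕ → Maybe Sign
signOf []                i j = nothing
signOf (e@(_ , _ , s) ∷ es) i j = if joins i j e then just s else signOf es i j

signOf-sym : ∀ es i j → signOf es i j ≡ signOf es j i
signOf-sym []                   i j = refl
signOf-sym ((k , l , s) ∷ es) i j =
  cong₂ (if_then just s else_) (∨-comm ((k ≡ᵇ i) ∧ (l ≡ᵇ j)) _) (signOf-sym es i j)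

joins⇒ : ∀ i j {k l s} → T (joins i j (k , l , s)) → (k ≡ i × l ≡ j) ⊎ (k ≡ j × l ≡ i)
joins⇒ i j {k} {l} t = Sum.map (equal i j) (equal j i) (Equivalence.to T-∨ t)
  where
  equal : ∀ m n → T ((k ≡ᵇ m) ∧ (l ≡ᵇ n)) → k ≡ m × l ≡ n
  equal m n = Product.map (ℕₚ.≡ᵇ⇒≡ k m) (ℕₚ.≡ᵇ⇒≡ l n) ∘ Equivalence.to T-∧

-- Edges are stored in one direction only, hence the symmetry hypothesis on Q.
signOf-elim : ∀ {Q : ℕ → ℕ → Set} → (∀ {i j} → Q i j → Q j i) →
              ∀ {es} → All (λ (i , j , _) → Q i j) es →
              ∀ {i j s} → signOf es i j ≡ just s → Q i j
signOf-elim Q-sym {(k , l , t) ∷ es} (q ∷ qs) {i} {j} eq with joins i j (k , l , t) in joined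
... | false = signOf-elim Q-sym qs eq
... | true with joins⇒ i j {k} {l} {t} (Equivalence.from T-≡ joined)
...   | inj₁ (refl , refl) = q
...   | inj₂ (refl , refl) = Q-sym q

signOf-loopless : ∀ {es} → All (λ (i , j , _) → i ≢ j) es → ∀ i → signOf es i i ≡ nothing
signOf-loopless {es} loopless i with signOf es i i in eq
... | nothing = refl
... | just _  = contradiction refl (signOf-elim (λ i≢j → i≢j ∘ ≡-sym) loopless eq)

fromEdges : ℕ → (es : List Edge) → All (λ (i , j , _) → i ≢ j) es → SignedGraph
fromEdges m es loopless = record
  { n      = m
  ; sig    = λ u v → signOf es (toℕ u) (toℕ v)
  ; sym    = λ u v → signOf-sym es (toℕ u) (toℕ v)
  ; noLoop = λ v → signOf-loopless loopless (toℕ v)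
  }

-- Finite tests that certify a straight-line drawing

Off : (ℕ → GridPoint) → ℕ → ℕ → ℕ → Set
Off P i j w = w ≡ i ⊎ w ≡ j ⊎ Left (P i) (P j) (P w) ⊎ Left (P j) (P i) (P w)

-- Edges with a common end are exempt, as in `StraightLineDrawing`. In particular the relation is
-- reflexive, which covers an edge paired with itself.
NonCrossing : (ℕ → GridPoint) → Edge → Edge → Set
NonCrossing P (i , j , _) (k , l , _) = i ≡ k ⊎ i ≡ l ⊎ j ≡ k ⊎ j ≡ l ⊎ Apart (P i) (P j) (P k) (P l)

left? : ∀ a b c → Dec (Left a b c)
left? a b c = loop b a c <? loop a b c

beside? : ∀ a b c d → Dec (Beside a b c d)
beside? a b c d = (left? a b c ×-dec left? a b d) ⊎-dec (left? b a c ×-dec left? b a d)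

off? : ∀ P i j w → Dec (Off P i j w)
off? P i j w = (w ℕ.≟ i) ⊎-dec (w ℕ.≟ j) ⊎-dec left? (P i) (P j) (P w) ⊎-dec left? (P j) (P i) (P w)

nonCrossing? : ∀ P e f → Dec (NonCrossing P e f)
nonCrossing? P (i , j , _) (k , l , _) =
  (i ℕ.≟ k) ⊎-dec (i ℕ.≟ l) ⊎-dec (j ℕ.≟ k) ⊎-dec (j ℕ.≟ l) ⊎-dec
  (beside? (P i) (P j) (P k) (P l) ⊎-dec beside? (P k) (P l) (P i) (P j))

off⇒ : ∀ P i j w → Off P i j w → w ≢ i → w ≢ j → ¬ OnSegment ⟦ P w ⟧ ⟦ P i ⟧ ⟦ P j ⟧
off⇒ P i j w (inj₁ eq)                       w≢i w≢j = contradiction eq w≢i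
off⇒ P i j w (inj₂ (inj₁ eq))                w≢i w≢j = contradiction eq w≢j
off⇒ P i j w (inj₂ (inj₂ (inj₁ left)))       w≢i w≢j = left-not-on-segment (P i) (P j) (P w) left
off⇒ P i j w (inj₂ (inj₂ (inj₂ left)))       w≢i w≢j =
  left-not-on-segment (P j) (P i) (P w) left ∘ onSegment-sym ⟦ P w ⟧ ⟦ P i ⟧ ⟦ P j ⟧

nonCrossing⇒ : ∀ P {i j k l s t} → NonCrossing P (i , j , s) (k , l , t) →
               i ≢ k → i ≢ l → j ≢ k → j ≢ l → Disjoint ⟦ P i ⟧ ⟦ P j ⟧ ⟦ P k ⟧ ⟦ P l ⟧
nonCrossing⇒ P (inj₁ eq)                             n₁ n₂ n₃ n₄ = contradiction eq n₁
nonCrossing⇒ P (inj₂ (inj₁ eq))                      n₁ n₂ n₃ n₄ = contradiction eq n₂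
nonCrossing⇒ P (inj₂ (inj₂ (inj₁ eq)))               n₁ n₂ n₃ n₄ = contradiction eq n₃
nonCrossing⇒ P (inj₂ (inj₂ (inj₂ (inj₁ eq))))        n₁ n₂ n₃ n₄ = contradiction eq n₄
nonCrossing⇒ P {i} {j} {k} {l} (inj₂ (inj₂ (inj₂ (inj₂ apart)))) n₁ n₂ n₃ n₄ =
  apart-disjoint (P i) (P j) (P k) (P l) apart

nonCrossing-sym : ∀ P {e f} → NonCrossing P e f → NonCrossing P f e
nonCrossing-sym P (inj₁ eq)                             = inj₁ (≡-sym eq)
nonCrossing-sym P (inj₂ (inj₁ eq))                      = inj₂ (inj₂ (inj₁ (≡-sym eq)))
nonCrossing-sym P (inj₂ (inj₂ (inj₁ eq)))               = inj₂ (inj₁ (≡-sym eq))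
nonCrossing-sym P (inj₂ (inj₂ (inj₂ (inj₁ eq))))        = inj₂ (inj₂ (inj₂ (inj₁ (≡-sym eq))))
nonCrossing-sym P (inj₂ (inj₂ (inj₂ (inj₂ apart))))     = inj₂ (inj₂ (inj₂ (inj₂ (Sum.swap apart))))

-- `AllPairs` tests each unordered pair of list positions once; reflexivity supplies the diagonal
-- and symmetry the other half.
allPairs⇒all : {A : Set} {R : A → A → Set} → (∀ {x} → R x x) → (∀ {x y} → R x y → R y x) →
               ∀ {xs} → AllPairs R xs → All (λ x → All (R x) xs) xs
allPairs⇒all R-refl R-sym []         = []
allPairs⇒all R-refl R-sym (rs ∷ rss) =
  (R-refl ∷ rs) ∷ All.zipWith (λ (r , rs′) → R-sym r ∷ rs′) (rs , allPairs⇒all R-refl R-sym rss)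

module _ (P : ℕ → GridPoint) (m : ℕ) (es : List Edge) (loopless : All (λ (i , j , _) → i ≢ j) es)
  (distinct    : ∀ (u v : Fin m) → P (toℕ u) ≡ P (toℕ v) → u ≡ v)
  (off         : All (λ (i , j , _) → All (Off P i j) (upTo m)) es)
  (nonCrossing : AllPairs (NonCrossing P) es)
  where

  private
    G = fromEdges m es loopless

    NoVertexInside : ℕ → ℕ → Set
    NoVertexInside i j = ∀ (w : Fin m) → toℕ w ≢ i → toℕ w ≢ j →
                         ¬ OnSegment ⟦ P (toℕ w) ⟧ ⟦ P i ⟧ ⟦ P j ⟧

    NoCrossing : ℕ → ℕ → ℕ → ℕ → Set
    NoCrossing i j k l = i ≢ k → i ≢ l → j ≢ k → j ≢ l → Disjoint ⟦ P i ⟧ ⟦ P j ⟧ ⟦ P k ⟧ ⟦ P l ⟧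

    noVertexInside : ∀ {i j s} → signOf es i j ≡ just s → NoVertexInside i j
    noVertexInside = signOf-elim {NoVertexInside}
      (λ {i} {j} out w w≢j w≢i → out w w≢i w≢j ∘ onSegment-sym ⟦ P (toℕ w) ⟧ ⟦ P j ⟧ ⟦ P i ⟧)
      (All.map (λ {(i , j , _)} offs w →
        off⇒ P i j (toℕ w) (All.lookup offs (∈-upTo⁺ (toℕ<n w)))) off)

    noCrossing : ∀ {i j s k l t} → signOf es i j ≡ just s → signOf es k l ≡ just t → NoCrossing i j k l
    -- `signOf-elim` is applied once per edge: the inner use selects the first edge and keeps the
    -- whole list for the second, which the outer use selects. The side conditions say that
    -- reversing either edge preserves disjointness.
    noCrossing eij = signOf-elim {λ k l → NoCrossing _ _ k l}
      (λ {k} {l} free n₁ n₂ n₃ n₄ (x , on₁ , on₂) →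
        free n₂ n₁ n₄ n₃ (x , on₁ , onSegment-sym x ⟦ P l ⟧ ⟦ P k ⟧ on₂))
      (signOf-elim {λ i j → All (λ (k , l , _) → NoCrossing i j k l) es}
        (λ {i} {j} → All.map λ free n₁ n₂ n₃ n₄ (x , on₁ , on₂) →
          free n₃ n₄ n₁ n₂ (x , onSegment-sym x ⟦ P j ⟧ ⟦ P i ⟧ on₁ , on₂))
        (All.map (λ {(i , j , s)} → All.map λ {(k , l , t)} → nonCrossing⇒ P {i} {j} {k} {l} {s} {t})
          (allPairs⇒all {R = NonCrossing P} (λ { {_ , _ , _} → inj₁ refl })
            (λ {e} {f} → nonCrossing-sym P {e} {f}) nonCrossing))
        eij)

  drawing : Planar G
  drawing = (λ u → ⟦ P (toℕ u) ⟧) ,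
    (λ u v eq → distinct u v (⟦⟧-injective eq)) ,
    (λ a b w (_ , ab) w≢a w≢b → noVertexInside ab w (w≢a ∘ toℕ-injective) (w≢b ∘ toℕ-injective)) ,
    (λ a b c d (_ , ab) (_ , cd) a≢c a≢d b≢c b≢d →
      noCrossing ab cd (a≢c ∘ toℕ-injective) (a≢d ∘ toℕ-injective)
                       (b≢c ∘ toℕ-injective) (b≢d ∘ toℕ-injective))

-- The graph

-- All edge signs, coordinates, cycles and search orders below were found by computer.  The core has
-- vertices 0, …, 17.  Vertices 0, 1, 2 of the gadget are identified with core vertices, and the
-- triangle on them (all negative) is listed with the core.
coreNegative : List (ℕ × ℕ)
coreNegative =
  (0 , 1) ∷ (0 , 2) ∷ (0 , 3) ∷ (0 , 4) ∷ (0 , 7) ∷ (1 , 2) ∷ (1 , 4) ∷ (1 , 6) ∷ (1 , 7) ∷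
  (1 , 8) ∷ (1 , 10) ∷ (2 , 3) ∷ (2 , 5) ∷ (2 , 6) ∷ (2 , 7) ∷ (2 , 8) ∷ (2 , 13) ∷ (3 , 4) ∷
  (3 , 5) ∷ (3 , 13) ∷ (3 , 15) ∷ (4 , 9) ∷ (4 , 14) ∷ (5 , 6) ∷ (5 , 13) ∷ (5 , 15) ∷
  (6 , 8) ∷ (6 , 10) ∷ (9 , 10) ∷ (9 , 11) ∷ (9 , 12) ∷ (10 , 11) ∷ (10 , 12) ∷ (11 , 12) ∷
  (14 , 15) ∷ (14 , 16) ∷ (14 , 17) ∷ (15 , 16) ∷ (15 , 17) ∷ (16 , 17) ∷ []

corePositive : List (ℕ × ℕ)
corePositive =
  (1 , 11) ∷ (3 , 16) ∷ (4 , 5) ∷ (4 , 6) ∷ (4 , 11) ∷ (4 , 16) ∷ (5 , 14) ∷ (6 , 9) ∷ []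

gadgetNegative : List (ℕ × ℕ)
gadgetNegative =
  (0 , 6) ∷ (0 , 7) ∷ (0 , 10) ∷ (1 , 7) ∷ (1 , 12) ∷ (2 , 3) ∷ (2 , 17) ∷ (3 , 4) ∷ (3 , 5) ∷
  (3 , 6) ∷ (3 , 9) ∷ (3 , 17) ∷ (3 , 19) ∷ (3 , 20) ∷ (4 , 5) ∷ (4 , 6) ∷ (4 , 7) ∷ (4 , 8) ∷
  (4 , 19) ∷ (4 , 21) ∷ (4 , 22) ∷ (5 , 8) ∷ (5 , 9) ∷ (5 , 20) ∷ (5 , 21) ∷ (6 , 7) ∷
  (6 , 10) ∷ (6 , 16) ∷ (6 , 19) ∷ (7 , 8) ∷ (7 , 10) ∷ (7 , 11) ∷ (7 , 22) ∷ (8 , 11) ∷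
  (8 , 21) ∷ (8 , 22) ∷ (9 , 20) ∷ (11 , 12) ∷ (11 , 13) ∷ (11 , 14) ∷ (12 , 13) ∷ (12 , 14) ∷
  (13 , 14) ∷ (15 , 16) ∷ (15 , 17) ∷ (15 , 18) ∷ (16 , 17) ∷ (16 , 18) ∷ (17 , 18) ∷ []

gadgetPositive : List (ℕ × ℕ)
gadgetPositive =
  (1 , 5) ∷ (1 , 8) ∷ (1 , 9) ∷ (1 , 13) ∷ (2 , 6) ∷ (2 , 9) ∷ (2 , 16) ∷ (3 , 15) ∷ (6 , 15) ∷
  (7 , 13) ∷ (8 , 12) ∷ []

-- Here and in `gadgetK₄` all six edges of each K₄ are negative, hence so are its four triangles.
-- The corner listed last has no neighbours besides the other three.
coreK₄ : List K₄
coreK₄ =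
  (0 , 1 , 2 , 7) ∷ (1 , 2 , 6 , 8) ∷ (9 , 10 , 11 , 12) ∷ (2 , 3 , 5 , 13) ∷
  (14 , 15 , 16 , 17) ∷ []

gadgetK₄ : List K₄
gadgetK₄ =
  (0 , 6 , 7 , 10) ∷ (11 , 12 , 13 , 14) ∷ (15 , 16 , 17 , 18) ∷ (3 , 4 , 6 , 19) ∷
  (3 , 5 , 9 , 20) ∷ (4 , 5 , 8 , 21) ∷ (4 , 7 , 8 , 22) ∷ []

coreCycles : List (List ℕ)
coreCycles =
  (0 ∷ 3 ∷ 4 ∷ []) ∷ (0 ∷ 4 ∷ 1 ∷ []) ∷ (0 ∷ 4 ∷ 5 ∷ 2 ∷ []) ∷ (0 ∷ 4 ∷ 6 ∷ 2 ∷ []) ∷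
  (1 ∷ 6 ∷ 10 ∷ []) ∷ (1 ∷ 11 ∷ 4 ∷ []) ∷ (2 ∷ 5 ∷ 3 ∷ []) ∷ (2 ∷ 6 ∷ 4 ∷ 3 ∷ []) ∷
  (3 ∷ 4 ∷ 16 ∷ []) ∷ (3 ∷ 5 ∷ 15 ∷ []) ∷ (4 ∷ 5 ∷ 14 ∷ []) ∷ (4 ∷ 6 ∷ 5 ∷ []) ∷
  (4 ∷ 9 ∷ 6 ∷ []) ∷ []

gadgetCycles : List (List ℕ)
gadgetCycles =
  (1 ∷ 2 ∷ 0 ∷ []) ∷ (1 ∷ 2 ∷ 3 ∷ 5 ∷ []) ∷ (1 ∷ 2 ∷ 6 ∷ 4 ∷ 5 ∷ []) ∷ (1 ∷ 2 ∷ 9 ∷ []) ∷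
  (1 ∷ 7 ∷ 4 ∷ 3 ∷ 2 ∷ []) ∷ (1 ∷ 7 ∷ 4 ∷ 5 ∷ []) ∷ (1 ∷ 7 ∷ 6 ∷ 2 ∷ []) ∷ (1 ∷ 8 ∷ 5 ∷ []) ∷
  (1 ∷ 8 ∷ 12 ∷ []) ∷ (1 ∷ 13 ∷ 7 ∷ []) ∷ (2 ∷ 6 ∷ 16 ∷ []) ∷ (2 ∷ 17 ∷ 3 ∷ []) ∷
  (3 ∷ 6 ∷ 4 ∷ []) ∷ (3 ∷ 15 ∷ 6 ∷ []) ∷ (7 ∷ 8 ∷ 11 ∷ []) ∷ []

-- Both orders omit the last corner of every K₄: excluding the other three corners already lowers
-- the cap, so the fourth never has to be decided. `gadgetOrder` also omits 1 and 2, which are fixed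
-- in advance.
coreOrder : List ℕ
coreOrder =
  6 ∷ 4 ∷ 5 ∷ 3 ∷ 0 ∷ 2 ∷ 1 ∷ 11 ∷ 16 ∷ 10 ∷ 9 ∷ 14 ∷ 15 ∷ []

gadgetOrder : List ℕ
gadgetOrder =
  9 ∷ 0 ∷ 3 ∷ 5 ∷ 7 ∷ 6 ∷ 4 ∷ 8 ∷ 17 ∷ 12 ∷ 15 ∷ 16 ∷ 13 ∷ 11 ∷ []

coordinates : List GridPoint
coordinates =
  (29 , 48) ∷ (37 , 65) ∷ (40 , 41) ∷ (81 , 8) ∷ (0 , 0) ∷ (100 , 0) ∷ (44 , 97) ∷ (35 , 51) ∷
  (41 , 68) ∷ (12 , 24) ∷ (38 , 82) ∷ (32 , 58) ∷ (27 , 55) ∷ (73 , 16) ∷ (80 , 1) ∷ (75 , 7) ∷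
  (25 , 1) ∷ (60 , 3) ∷ (40 , 16) ∷ (19 , 15) ∷ (59 , 22) ∷ (13 , 2) ∷ (15 , 23) ∷ (49 , 27) ∷
  (74 , 12) ∷ (11 , 4) ∷ (41 , 28) ∷ (33 , 43) ∷ (24 , 27) ∷ (30 , 32) ∷ (41 , 12) ∷ (28 , 5) ∷
  (66 , 8) ∷ (45 , 9) ∷ (24 , 11) ∷ (58 , 17) ∷ (42 , 21) ∷ (28 , 22) ∷ (64 , 48) ∷ (52 , 44) ∷
  (73 , 44) ∷ (43 , 62) ∷ (51 , 35) ∷ (77 , 31) ∷ (51 , 84) ∷ (44 , 47) ∷ (76 , 26) ∷
  (90 , 9) ∷ (63 , 28) ∷ (76 , 22) ∷ (59 , 56) ∷ (46 , 67) ∷ (48 , 86) ∷ (51 , 70) ∷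
  (53 , 51) ∷ (63 , 58) ∷ (68 , 40) ∷ (61 , 37) ∷ []
-- The gadget has labels 0 to 22. The first three are glued to a core triangle and the other 20 are
-- numbered from `o`; hence the offsets 18 and 38 and the total of 58 vertices.
place : ℕ × ℕ × ℕ → ℕ → ℕ → ℕ
place (x , y , z) o 0 = x
place (x , y , z) o 1 = y
place (x , y , z) o 2 = z
place (x , y , z) o (suc (suc (suc i))) = o + i

left right : ℕ → ℕ
left  = place (4 , 0 , 3) 18
right = place (2 , 5 , 6) 38

edges : (ℕ → ℕ) → List (ℕ × ℕ) → Sign → List Edge
edges f ijs s = map (λ (i , j) → f i , f j , s) ijs

allEdges : List Edge
allEdges =
  edges id coreNegative Sign.- ++ edges id corePositive Sign.+ ++
  edges left gadgetNegative Sign.- ++ edges left gadgetPositive Sign.+ ++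
  edges right gadgetNegative Sign.- ++ edges right gadgetPositive Sign.+

loopless : All (λ (i , j , _) → i ≢ j) allEdges
loopless = from-yes (All.all? (λ (i , j , _) → ¬? (i ℕ.≟ j)) allEdges)

graph : SignedGraph
graph = fromEdges 58 allEdges loopless

nth : List GridPoint → ℕ → GridPoint
nth []       _       = 0 , 0
nth (x ∷ xs) 0       = x
nth (x ∷ xs) (suc i) = nth xs i

position : ℕ → GridPoint
position = nth coordinates

abstract
  planar : Planar graph
  planar = drawing position 58 allEdges loopless
    (toWitness {a? = Finₚ.all? λ u → Finₚ.all? λ v →
      ≡-dec ℕ._≟_ ℕ._≟_ (position (toℕ u)) (position (toℕ v)) →-dec (u Finₚ.≟ v)} tt)
    (toWitness {a? = All.all? (λ (i , j , _) → All.all? (off? position i j) (upTo 58)) allEdges} tt)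
    (toWitness {a? = allPairs? (nonCrossing? position) allEdges} tt)

placeK₄ : (ℕ → ℕ) → K₄ → K₄
placeK₄ f (a , b , c , d) = f a , f b , f c , f d

leftK₄ rightK₄ : List K₄
leftK₄  = map (placeK₄ left)  gadgetK₄
rightK₄ = map (placeK₄ right) gadgetK₄

leftCycles rightCycles cycles : List (List ℕ)
leftCycles  = map (map left)  gadgetCycles
rightCycles = map (map right) gadgetCycles
cycles = coreCycles ++ leftCycles ++ rightCycles ++
         concatMap triangles coreK₄ ++ concatMap triangles leftK₄ ++ concatMap triangles rightK₄

-- Every label in use is below 58, so the reduction mod 58 only supplies the bound.
vertex : ℕ → Fin 58
vertex i = i mod 58

negativeCycle? : ∀ G vs → Dec (NegativeCycle G vs)
negativeCycle? G vs =
  unique? Finₚ._≟_ vs ×-dec (3 ≤? length vs) ×-dec Maybeₚ.≡-dec Sign._≟_ (pathSign G (cycleEdges G vs)) (just Sign.-)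

abstract
  cycles-negative : All (NegativeCycle graph ∘ map vertex) cycles
  cycles-negative = toWitness {a? = All.all? (negativeCycle? graph ∘ map vertex) cycles} tt

  -- The pairs 0, 3 and 5, 6 are the images of the gadget vertices 1 and 2 under `left` and `right`.
  left-search : T (gadgetSearch leftCycles leftK₄ (map left gadgetOrder) 0 3)
  left-search = tt

  right-search : T (gadgetSearch rightCycles rightK₄ (map right gadgetOrder) 5 6)
  right-search = tt

-- The bound of 40 on balanced sets

extra : List ℕ
extra = 0 ∷ 3 ∷ 4 ∷ 5 ∷ 6 ∷ []

-- The gadgets enter only through the pairs 0, 3 and 5, 6, so the search can stay within the core.
-- `certain` is used there because the cap 13 is justified only once both vertices are known to be
-- taken.
upperBound : Partial → ℕ
upperBound σ = count (possible σ) extra +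
  (scoreCap σ coreK₄ + (gadgetCap (certain σ) 0 3 + gadgetCap (certain σ) 5 6))

abstract
  -- The caps start at 10 + 14 + 14 = 38, so 40 leaves room for two members of `extra`.
  core-search : T (Search.search coreCycles (λ σ → upperBound σ ≤ᵇ 40) coreOrder empty)
  core-search = tt

-- Its length is 5 + 4 · 19 = 81.
occurrences : List ℕ
occurrences = extra ++ concatMap corners coreK₄ ++ concatMap corners leftK₄ ++ concatMap corners rightK₄

count-occurrences-≤ : ∀ {S} → Avoids S cycles → count S occurrences ≤ 40
count-occurrences-≤ {S} avoids =
  Search.search-sound coreCycles _ avoidsCore
    (λ σ ext enough → ℕₚ.≤-trans (bound ext) (ℕₚ.≤ᵇ⇒≤ _ _ enough)) coreOrder empty ⊨-empty core-search
  where
  avoidsCore  = Allₚ.++⁻ˡ coreCycles avoids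
  rest₁       = Allₚ.++⁻ʳ coreCycles avoids
  avoidsLeft  = Allₚ.++⁻ˡ leftCycles rest₁
  rest₂       = Allₚ.++⁻ʳ leftCycles rest₁
  avoidsRight = Allₚ.++⁻ˡ rightCycles rest₂
  rest₃       = Allₚ.++⁻ʳ rightCycles rest₂
  avoidsCoreK = Allₚ.++⁻ˡ (concatMap triangles coreK₄) rest₃
  rest₄       = Allₚ.++⁻ʳ (concatMap triangles coreK₄) rest₃
  avoidsLeftK  = Allₚ.++⁻ˡ (concatMap triangles leftK₄) rest₄
  avoidsRightK = Allₚ.++⁻ʳ (concatMap triangles leftK₄) rest₄

  gadgetBound : ∀ {σ} → S ⊨ σ → ∀ {Ks y z} → score S Ks ≤ gadgetCap S y z →
                score S Ks ≤ gadgetCap (certain σ) y z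
  gadgetBound ext {y = y} {z} ≤cap = ℕₚ.≤-trans ≤cap (gadgetCap-antitone y z (certain⇒member ext))

  split : count S occurrences ≡ count S extra + (score S coreK₄ + (score S leftK₄ + score S rightK₄))
  split = count-++₄ S extra (concatMap corners coreK₄) (concatMap corners leftK₄) (concatMap corners rightK₄)

  bound : ∀ {σ} → S ⊨ σ → count S occurrences ≤ upperBound σ
  bound {σ} ext = subst (_≤ upperBound σ) (≡-sym split)
    (ℕₚ.+-mono-≤ (count-mono (member⇒possible ext) extra)
    (ℕₚ.+-mono-≤ (score≤scoreCap ext coreK₄ avoidsCoreK)
    (ℕₚ.+-mono-≤
      (gadgetBound ext {leftK₄} (score≤gadgetCap leftCycles leftK₄ (map left gadgetOrder) 0 3
        avoidsLeft avoidsLeftK refl left-search))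
      (gadgetBound ext {rightK₄} (score≤gadgetCap rightCycles rightK₄ (map right gadgetOrder) 5 6
        avoidsRight avoidsRightK refl right-search)))))

-- From balanced sets to colorings

balanced⇒avoids : ∀ {p} G (f : ℕ → Fin (n G)) (c : Fin (n G) → Subset p) k →
                  Balanced G (λ v → k ∈ c v) →
                  ∀ {cs} → All (NegativeCycle G ∘ map f) cs → Avoids (λ v → lookup (c (f v)) k) cs
balanced⇒avoids G f c k balanced = All.map λ {C} negative all →
  balanced (map f C) negative
    (Allₚ.map⁺ (All.map (λ {v} → lookup⇒[]= k (c (f v)) ∘ Equivalence.to T-≡) all))

81q≤40p : ∀ p q → BalancedColoring graph p q → 81 * q ≤ p * 40
81q≤40p p q (_ , _ , c , sizes , balanced) =
  double-count (c ∘ vertex) (sizes ∘ vertex) occurrences 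
    (λ k → count-occurrences-≤ (balanced⇒avoids graph vertex c k (balanced k) cycles-negative))

-- In fractions, a/b < 83/41 < 81/40 ≤ p/q, cross-multiplied with 1640 = 40 · 41. The middle
-- inequality is 83 · 40 = 3320 < 3321 = 81 · 41.
<-from-81/40 : ∀ {a b p q} → 1 ≤ q → a * 41 < 83 * b → 81 * q ≤ p * 40 → a * q < p * b
<-from-81/40 {a} {b} {p} {q} 1≤q 41a<83b 81q≤40p = ℕₚ.*-cancelˡ-< 1640 (a * q) (p * b) (begin-strict
  1640 * (a * q)        ≡⟨ solve 2 (λ a q → con 1640 :* (a :* q) := (a :* con 41) :* (q :* con 40)) refl a q ⟩
  (a * 41) * (q * 40)   <⟨ ℕₚ.*-monoˡ-< (q * 40) {{ℕₚ.m*n≢0 q 40 {{ℕ.>-nonZero 1≤q}}}} 41a<83b ⟩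
  (83 * b) * (q * 40)   ≡⟨ solve 2 (λ b q → (con 83 :* b) :* (q :* con 40) := con 3320 :* (b :* q)) refl b q ⟩
  3320 * (b * q)        ≤⟨ ℕₚ.*-monoˡ-≤ (b * q) (ℕₚ.n≤1+n 3320) ⟩
  3321 * (b * q)        ≡⟨ solve 2 (λ b q → con 3321 :* (b :* q) := (con 41 :* b) :* (con 81 :* q)) refl b q ⟩
  (41 * b) * (81 * q)   ≤⟨ ℕₚ.*-monoʳ-≤ (41 * b) 81q≤40p ⟩
  (41 * b) * (p * 40)   ≡⟨ solve 2 (λ b p → (con 41 :* b) :* (p :* con 40) := con 1640 :* (p :* b)) refl b p ⟩
  1640 * (p * b)        ∎)
  where
  open ℕₚ.≤-Reasoning
  open Data.Nat.Solver.+-*-Solver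

-- A supremum is at least 83/41 once every nonnegative rational a/b below 83/41 is exceeded by some
-- value. The same `graph` serves for all `a` and `b`.
theorem2 : (a b : ℕ) → 0 < b → a * 41 < 83 * b →
    Σ SignedGraph (λ G → Planar G ×
    ((p q : ℕ) → BalancedColoring G p q → a * q < p * b))
theorem2 a b 0<b 41a<83b = graph , planar ,
  λ p q coloring → <-from-81/40 {a} {b} {p} {q} (proj₁ (proj₂ coloring)) 41a<83b (81q≤40p p q coloring)
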